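{- Let $\mathcal{H}=(V,\mathcal{E},f)$ be an edge-weighted hypergraph such that for every $e\in\mathcal{E}$ the edge-weight function $f_e$ is non-decreasing and concave with $f_e(0)=0$. Then $\{v\}$, where $v\in\arg\max_{u\in V}\sum_{e\in\mathcal{E}:\,u\in e}f_e(1)$, is an optimal solution of GDSH; that is, $\frac{F(\{v\})}{1}=\max_{\emptyset\ne S\subseteq V}\frac{F(S)}{|S|}$.
   Context: An edge-weighted hypergraph $\mathcal{H}=(V,\mathcal{E},f)$ consists of a finite nonempty vertex set $V$, a finite set $\mathcal{E}$ of nonempty subsets of $V$ (hyperedges), and for each $e\in\mathcal{E}$ an edge-weight function $f_e:\{0,\dots,|e|\}\to\mathbb{R}_{\ge 0}$. The function $f_e$ is non-decreasing if $f_e(i)\le f_e(i+1)$ for all $i\in\{0,\dots,|e|-1\}$, and concave if $f_e(i)-f_e(i-1)\ge f_e(i+1)-f_e(i)$ for all $i\in\{1,\dots,|e|-1\}$. For $S\subseteq V$, $F(S)=\sum_{e\in\mathcal{E}}f_e(|e\cap S|)$. The generalized densest sub-hypergraph problem (GDSH) asks for a nonempty $S\subseteq V$ maximizing $F(S)/|S|$. -}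

module Defs where

open import Data.Fin using (Fin; toℕ; fromℕ<)
open import Data.Fin.Subset using (Subset; Nonempty; ⁅_⁆; ∣_∣; _∩_; _∈_)
open import Data.Fin.Subset.Properties using (_∈?_; x∈p⇒∣p-x∣<∣p∣; x∈⁅x⁆; ∣p∩q∣≤∣p∣)
open import Data.Integer as ℤ using (+_)
open import Data.List using (List; map; foldr; filter; allFin)
open import Data.Nat as ℕ using (ℕ; suc; z≤n; s≤s; NonZero; _⊔_)
import Data.Nat.Properties as ℕ
open import Data.Product using (Σ; ∃-syntax; _×_; _,_)
open import Data.Rational as ℚ using (ℚ; 0ℚ; 1ℚ; ½)
import Data.Rational.Properties as ℚ
import Data.Rational.Unnormalised as ℚᵘ
import Data.Rational.Unnormalised.Properties as ℚᵘ
open import Data.Rational.Solver using (module +-*-Solver)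
open import Function.Definitions using (Injective)
open import Relation.Binary.PropositionalEquality using (_≡_; refl; sym; trans; cong; subst)

Cauchy : (ℕ → ℚ) → Set
Cauchy x = ∀ ε → 0ℚ ℚ.< ε →
  ∃[ N ] (∀ m n → N ℕ.≤ m → N ℕ.≤ n → ℚ.∣ x m ℚ.- x n ∣ ℚ.< ε)

record ℝ : Set where
  constructor mkℝ
  field
    seq    : ℕ → ℚ
    cauchy : Cauchy seq

open ℝ public

infix 4 _≈_ _≤_

-- Equality of reals is this equivalence, not _≡_.
_≈_ : ℝ → ℝ → Set
x ≈ y = ∀ ε → 0ℚ ℚ.< ε →
  ∃[ N ] (∀ n → N ℕ.≤ n → ℚ.∣ seq x n ℚ.- seq y n ∣ ℚ.< ε)

_≤_ : ℝ → ℝ → Set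
x ≤ y = ∀ ε → 0ℚ ℚ.< ε →
  ∃[ N ] (∀ n → N ℕ.≤ n → seq x n ℚ.< seq y n ℚ.+ ε)

0<½*ε : ∀ ε → 0ℚ ℚ.< ε → 0ℚ ℚ.< ½ ℚ.* ε
0<½*ε ε 0<ε = subst (ℚ._< ½ ℚ.* ε) (ℚ.*-zeroʳ ½) (ℚ.*-monoʳ-<-pos ½ 0<ε)

halves : ∀ ε → ½ ℚ.* ε ℚ.+ ½ ℚ.* ε ≡ ε
halves ε = trans (sym (ℚ.*-distribʳ-+ ε ½ ½)) (ℚ.*-identityˡ ε)

+-interchange-- : ∀ a b c d →
  (a ℚ.+ b) ℚ.- (c ℚ.+ d) ≡ (a ℚ.- c) ℚ.+ (b ℚ.- d)
+-interchange-- = solve 4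
  (λ a b c d → (a :+ b) :+ :- (c :+ d) := (a :+ :- c) :+ (b :+ :- d)) refl
  where open +-*-Solver

*-distribˡ-- : ∀ a b c → a ℚ.* b ℚ.- a ℚ.* c ≡ a ℚ.* (b ℚ.- c)
*-distribˡ-- = solve 3 (λ a b c → a :* b :+ :- (a :* c) := a :* (b :+ :- c)) refl
  where open +-*-Solver

1/k≤1 : ∀ k .{{_ : NonZero k}} → + 1 ℚ./ k ℚ.≤ 1ℚ
1/k≤1 (suc k) = ℚ.toℚᵘ-cancel-≤
  (ℚᵘ.≤-respˡ-≃ (ℚᵘ.≃-sym (ℚ.toℚᵘ-fromℚᵘ (ℚᵘ.mkℚᵘ (+ 1) k)))
    (ℚᵘ.*≤* (ℤ.+≤+ (s≤s z≤n))))

0≤1/k : ∀ k .{{_ : NonZero k}} → 0ℚ ℚ.≤ + 1 ℚ./ k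
0≤1/k k = ℚ.nonNegative⁻¹ _ {{ℚ.normalize-nonNeg 1 k}}

infixl 6 _+_ _-_
infix  8 -_
infixl 7 _÷_

0ℝ : ℝ
0ℝ = mkℝ (λ _ → 0ℚ) (λ _ 0<ε → 0 , λ _ _ _ _ → 0<ε)

_+_ : ℝ → ℝ → ℝ
x + y = mkℝ (λ n → seq x n ℚ.+ seq y n) λ ε 0<ε →
  let Nx , hx = cauchy x (½ ℚ.* ε) (0<½*ε ε 0<ε)
      Ny , hy = cauchy y (½ ℚ.* ε) (0<½*ε ε 0<ε)
  in Nx ⊔ Ny , λ m n N≤m N≤n → ℚ.≤-<-trans
    (subst (λ q → ℚ.∣ q ∣ ℚ.≤ ℚ.∣ seq x m ℚ.- seq x n ∣ ℚ.+ ℚ.∣ seq y m ℚ.- seq y n ∣)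
      (sym (+-interchange-- (seq x m) (seq y m) (seq x n) (seq y n)))
      (ℚ.∣p+q∣≤∣p∣+∣q∣ (seq x m ℚ.- seq x n) (seq y m ℚ.- seq y n)))
    (subst (ℚ.∣ seq x m ℚ.- seq x n ∣ ℚ.+ ℚ.∣ seq y m ℚ.- seq y n ∣ ℚ.<_) (halves ε)
      (ℚ.+-mono-<
        (hx m n (ℕ.≤-trans (ℕ.m≤m⊔n Nx Ny) N≤m) (ℕ.≤-trans (ℕ.m≤m⊔n Nx Ny) N≤n))
        (hy m n (ℕ.≤-trans (ℕ.m≤n⊔m Nx Ny) N≤m) (ℕ.≤-trans (ℕ.m≤n⊔m Nx Ny) N≤n))))

-_ : ℝ → ℝ
- x = mkℝ (λ n → ℚ.- seq x n) λ ε 0<ε →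
  let N , h = cauchy x ε 0<ε
  in N , λ m n N≤m N≤n →
    subst (ℚ._< ε)
      (trans (sym (ℚ.∣-p∣≡∣p∣ (seq x m ℚ.- seq x n)))
        (cong ℚ.∣_∣ (ℚ.neg-distrib-+ (seq x m) (ℚ.- seq x n))))
      (h m n N≤m N≤n)

_-_ : ℝ → ℝ → ℝ
x - y = x + - y

_÷_ : ℝ → (k : ℕ) → .{{NonZero k}} → ℝ
x ÷ k = mkℝ (λ n → (+ 1 ℚ./ k) ℚ.* seq x n) λ ε 0<ε →
  let N , h = cauchy x ε 0<ε
      r = + 1 ℚ./ k
  in N , λ m n N≤m N≤n →
    let d = seq x m ℚ.- seq x n in
    ℚ.≤-<-trans
      (ℚ.≤-trans
        (ℚ.≤-reflexive
          (trans (cong ℚ.∣_∣ (*-distribˡ-- r (seq x m) (seq x n)))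
          (trans (ℚ.∣p*q∣≡∣p∣*∣q∣ r d)
                 (cong (ℚ._* ℚ.∣ d ∣) (ℚ.0≤p⇒∣p∣≡p (0≤1/k k))))))
        (ℚ.≤-trans
          (ℚ.*-monoʳ-≤-nonNeg ℚ.∣ d ∣ {{ℚ.∣-∣-nonNeg d}} (1/k≤1 k))
          (ℚ.≤-reflexive (ℚ.*-identityˡ ℚ.∣ d ∣))))
      (h m n N≤m N≤n)

sumOver : {A : Set} → List A → (A → ℝ) → ℝ
sumOver as g = foldr _+_ 0ℝ (map g as)

infix 4 _∈argmax_ _IsMaximumOf_

_∈argmax_ : {A : Set} → A → (A → ℝ) → Set
a ∈argmax g = ∀ b → g b ≤ g a

_IsMaximumOf_ : {A : Set} → ℝ → (A → ℝ) → Set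
m IsMaximumOf g = (∃[ a ] g a ≈ m) × (∀ a → g a ≤ m)

NonDecreasing : ∀ {c} → (Fin (suc c) → ℝ) → Set
NonDecreasing {c} w = ∀ (i j : Fin (suc c)) → toℕ j ≡ suc (toℕ i) → w i ≤ w j

-- The consecutive triple h, i, j is i-1, i, i+1, so that i ranges over {1,…,c-1}.
Concave : ∀ {c} → (Fin (suc c) → ℝ) → Set
Concave {c} w = ∀ (h i j : Fin (suc c)) →
  toℕ i ≡ suc (toℕ h) → toℕ j ≡ suc (toℕ i) → w j - w i ≤ w i - w h

nonempty⇒0<∣p∣ : ∀ {n} {p : Subset n} → Nonempty p → 0 ℕ.< ∣ p ∣
nonempty⇒0<∣p∣ (_ , x∈p) = ℕ.≤-<-trans z≤n (x∈p⇒∣p-x∣<∣p∣ x∈p)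

-- The vertex set is Fin n.  The set of hyperedges is enumerated without
-- repetition by Fin m.
record Hypergraph : Set where
  field
    n             : ℕ
    n≢0           : NonZero n
    m             : ℕ
    edge          : Fin m → Subset n
    edge-inj      : Injective _≡_ _≡_ edge
    edge-nonempty : ∀ e → Nonempty (edge e)
    weight        : ∀ e → Fin (suc ∣ edge e ∣) → ℝ
    weight-nonNeg : ∀ e i → 0ℝ ≤ weight e i

  Vertex : Set
  Vertex = Fin n

  F : Subset n → ℝ
  F S = sumOver (allFin m) λ e →
    weight e (fromℕ< {∣ edge e ∩ S ∣} (s≤s (∣p∩q∣≤∣p∣ (edge e) S)))

  weightAtOne : Fin m → ℝ
  weightAtOne e = weight e (fromℕ< {1} (s≤s (nonempty⇒0<∣p∣ (edge-nonempty e))))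

  weightedDegree : Vertex → ℝ
  weightedDegree u = sumOver (filter (λ e → u ∈? edge e) (allFin m)) weightAtOne

  NonemptySubset : Set
  NonemptySubset = Σ (Subset n) Nonempty

  singleton : Vertex → NonemptySubset
  singleton v = ⁅ v ⁆ , v , x∈⁅x⁆ v

  density : NonemptySubset → ℝ
  density (S , S≢∅) = _÷_ (F S) ∣ S ∣ {{ℕ.>-nonZero (nonempty⇒0<∣p∣ S≢∅)}}

  IsOptimalGDSH : NonemptySubset → Set
  IsOptimalGDSH S = S ∈argmax density

{-# OPTIONS --safe #-}
-- Concavity together with f_e(0) = 0 gives f_e(k) ≤ k f_e(1).  Summing this over the edges and
-- exchanging the order of summation,
--   F(S) ≤ Σ_e |e ∩ S| f_e(1) = Σ_{u ∈ S} Σ_{e ∋ u} f_e(1) ≤ |S| Σ_{e ∋ v} f_e(1) ≤ |S| F({v}).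
module Submission where

open import Defs
open import Data.Fin using (zero)
open import Data.Nat using ()
open import Data.Fin.Subset using (⁅_⁆)
open import Data.Product using (_×_)

open import Algebra.Bundles using (CommutativeMonoid; Ring)
import Algebra.Properties.CommutativeMonoid.Sum as CommutativeMonoidSum
import Algebra.Properties.Monoid.Mult as MonoidMult
import Algebra.Properties.Semiring.Mult as SemiringMult
open import Data.Bool.Base using (Bool; true; false; if_then_else_; _∧_)
open import Data.Bool.Properties using (∧-zeroʳ)
open import Data.Fin as Fin using (Fin; suc; toℕ; fromℕ<; inject₁)
open import Data.Fin.Induction using (<-weakInduction)
import Data.Fin.Properties as Fin
open import Data.Fin.Subset using (Subset; ∣_∣; _∩_; inside; outside)
open import Data.Fin.Subset.Properties using (_∈?_; ∩-zeroʳ; ∣⊥∣≡0; ∣⁅x⁆∣≡1; ∣p∩q∣≤∣p∣)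
open import Data.Integer as ℤ using (+_)
import Data.Integer.Properties as ℤ
open import Data.Integer.Solver using () renaming (module +-*-Solver to ℤ-Solver)
open import Data.List using (List; []; _∷_; foldr; map; filter; allFin; tabulate)
open import Data.Nat as ℕ using (ℕ; zero; suc; _⊔_; NonZero; s≤s)
import Data.Nat.Properties as ℕ
open import Data.Product using (_,_; proj₂)
open import Data.Rational as ℚ using (ℚ; 0ℚ; 1ℚ; ½)
import Data.Rational.Properties as ℚ
open import Data.Rational.Solver using () renaming (module +-*-Solver to ℚ-Solver)
import Data.Rational.Unnormalised as ℚᵘ
import Data.Rational.Unnormalised.Properties as ℚᵘ
open import Data.Sum using (inj₁; inj₂)
open import Data.Vec using (_∷_; []; lookup)
open import Data.Vec.Properties using (lookup-zipWith)
open import Function using (_∘_; id)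
open import Relation.Binary.Bundles using (Preorder)
open import Relation.Binary.Structures using (IsEquivalence; IsPreorder)
import Relation.Binary.Reasoning.Preorder as PreorderReasoning
open import Relation.Binary.PropositionalEquality
  using (_≡_; refl; sym; trans; cong; subst)
open import Relation.Nullary using (does)
open import Relation.Unary using (Pred; Decidable)
open import Level using (0ℓ) renaming (suc to lsuc; _⊔_ to _⊔ˡ_)

-- Finite sums and indicators

does-∈? : ∀ {n} u (p : Subset n) → does (u ∈? p) ≡ lookup p u
does-∈? zero    (inside  ∷ p) = refl
does-∈? zero    (outside ∷ p) = refl
does-∈? (suc u) (_       ∷ p) = does-∈? u p

-- Shows that an edge through `u` is evaluated at index 1 in `F ⁅ u ⁆`.
∣p∩⁅u⁆∣≡1 : ∀ {n} (p : Subset n) u → lookup p u ≡ inside → ∣ p ∩ ⁅ u ⁆ ∣ ≡ 1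
∣p∩⁅u⁆∣≡1 {suc n} (inside ∷ p) zero    refl = cong suc (trans (cong ∣_∣ (∩-zeroʳ p)) (∣⊥∣≡0 n))
∣p∩⁅u⁆∣≡1         (s ∷ p)      (suc u) u∈p  rewrite ∧-zeroʳ s = ∣p∩⁅u⁆∣≡1 p u u∈p

module IndicatorSums {a ℓ} (M : CommutativeMonoid a ℓ) where
  open CommutativeMonoid M
    using (Carrier; _∙_; ε; identityˡ; ∙-congˡ) renaming (_≈_ to _≋_)
  private module M = CommutativeMonoid M
  open CommutativeMonoidSum M using (sum; sum-syntax; sum-replicate-zero)
  open MonoidMult M.monoid using () renaming (_×_ to _·_)

  infix 5 _if_

  -- Stands in for multiplication by a 0/1 indicator. Sums over a subset or a filtered list become
  -- sums over a full index range, whose order can be exchanged.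
  _if_ : Carrier → Bool → Carrier
  x if b = if b then x else ε

  foldr-tabulate : ∀ {A : Set} {n} (f : Fin n → A) (g : A → Carrier) →
    foldr _∙_ ε (map g (tabulate f)) ≡ sum (g ∘ f)
  foldr-tabulate {n = zero}  f g = refl
  foldr-tabulate {n = suc n} f g = cong (g (f zero) ∙_) (foldr-tabulate (f ∘ suc) g)

  foldr-filter : ∀ {A : Set} {P : Pred A 0ℓ} (P? : Decidable P) (as : List A) (g : A → Carrier) →
    foldr _∙_ ε (map g (filter P? as)) ≋ foldr _∙_ ε (map (λ a → g a if does (P? a)) as)
  foldr-filter P? []       g = M.refl
  foldr-filter P? (a ∷ as) g with does (P? a)
  ... | true  = ∙-congˡ (foldr-filter P? as g)
  ... | false = M.trans (foldr-filter P? as g) (M.sym (identityˡ _))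

  if-cong : ∀ b {x y} → x ≋ y → (x if b) ≋ (y if b)
  if-cong true  x≋y = x≋y
  if-cong false x≋y = M.refl

  if-∧ : ∀ b c x → (x if b ∧ c) ≡ ((x if b) if c)
  if-∧ true  c     x = refl
  if-∧ false true  x = refl
  if-∧ false false x = refl

  sum-if : ∀ {n} b (g : Fin n → Carrier) → ∑[ i < n ] (g i if b) ≋ (sum g if b)
  sum-if     true  g = M.refl
  sum-if {n} false g = sum-replicate-zero n

  -- Read from right to left with `p` an intersection `e ∩ S`, this opens a multiple into a sum over
  -- vertices; read from left to right with `p` equal to `S`, it collects equal terms.
  sum-if-lookup : ∀ {n} (p : Subset n) x → ∑[ u < n ] (x if lookup p u) ≋ (∣ p ∣ · x)
  sum-if-lookup []            x = M.refl
  sum-if-lookup (inside  ∷ p) x = ∙-congˡ (sum-if-lookup p x)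
  sum-if-lookup (outside ∷ p) x = M.trans (identityˡ _) (sum-if-lookup p x)

  if-lookup-∩ : ∀ {n} (p q : Subset n) u x →
    (x if lookup (p ∩ q) u) ≋ ((x if lookup p u) if lookup q u)
  if-lookup-∩ p q u x = M.reflexive (trans
    (cong (x if_) (lookup-zipWith _∧_ u p q)) (if-∧ (lookup p u) (lookup q u) x))

  if-does-∈? : ∀ {n} u (p : Subset n) x → (x if does (u ∈? p)) ≋ (x if lookup p u)
  if-does-∈? u p x = M.reflexive (cong (x if_) (does-∈? u p))

-- The combinatorial argument uses only addition and order. Over an abstract carrier the relations
-- do not unfold to Cauchy sequences, so the elements they relate can stay implicit.
record OrderedCommutativeMonoid a ℓ₁ ℓ₂ : Set (lsuc (a ⊔ˡ ℓ₁ ⊔ˡ ℓ₂)) where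
  infix 4 _≼_
  field
    commutativeMonoid : CommutativeMonoid a ℓ₁
  open CommutativeMonoid commutativeMonoid public
    using (Carrier; _∙_; ε; monoid) renaming (_≈_ to _≋_)
  field
    _≼_         : Carrier → Carrier → Set ℓ₂
    isPreorder  : IsPreorder _≋_ _≼_
    ∙-mono      : ∀ {x y u v} → x ≼ y → u ≼ v → x ∙ u ≼ y ∙ v

  preorder : Preorder a ℓ₁ ℓ₂
  preorder = record { isPreorder = isPreorder }

  ≼-refl : ∀ {x} → x ≼ x
  ≼-refl = Preorder.refl preorder

-- Sums in ordered commutative monoids

module EdgeWeightBounds {a ℓ₁ ℓ₂} (M : OrderedCommutativeMonoid a ℓ₁ ℓ₂) where
  open OrderedCommutativeMonoid M
  open CommutativeMonoidSum commutativeMonoid using (sum; sum-syntax; sum-cong-≋; ∑-comm)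
  open MonoidMult monoid using () renaming (_×_ to _·_)
  open IndicatorSums commutativeMonoid
  open PreorderReasoning preorder

  ·-monoʳ : ∀ k {x y} → x ≼ y → k · x ≼ k · y
  ·-monoʳ zero    x≼y = ≼-refl
  ·-monoʳ (suc k) x≼y = ∙-mono x≼y (·-monoʳ k x≼y)

  sum-mono : ∀ {n} {f g : Fin n → Carrier} → (∀ i → f i ≼ g i) → sum f ≼ sum g
  sum-mono {zero}  f≼g = ≼-refl
  sum-mono {suc n} f≼g = ∙-mono (f≼g zero) (sum-mono (f≼g ∘ suc))

  if-mono : ∀ b {x y} → x ≼ y → (x if b) ≼ (y if b)
  if-mono true  x≼y = x≼y
  if-mono false x≼y = ≼-refl

  -- Telescoping: each step up adds at most `x`, starting from at most `ε`. The increment bound is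
  -- stated additively because a monoid has no subtraction.
  increments≼⇒subhomogeneous : ∀ {c} (w : Fin (suc c) → Carrier) x → w zero ≼ ε →
    (∀ i j → toℕ j ≡ suc (toℕ i) → w j ≼ x ∙ w i) → ∀ i → w i ≼ toℕ i · x
  increments≼⇒subhomogeneous w x w₀≼ε increment =
    <-weakInduction (λ i → w i ≼ toℕ i · x) w₀≼ε λ i ih → begin
      w (suc i)               ≲⟨ increment (inject₁ i) (suc i) (cong suc (sym (Fin.toℕ-inject₁ i))) ⟩
      x ∙ w (inject₁ i)       ≲⟨ ∙-mono ≼-refl ih ⟩
      x ∙ toℕ (inject₁ i) · x ≡⟨ cong (λ k → x ∙ k · x) (Fin.toℕ-inject₁ i) ⟩
      x ∙ toℕ i · x           ∎

  module _ {n m} (edge : Fin m → Subset n) (weight : ∀ e → Fin (suc ∣ edge e ∣) → Carrier)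
           (weightAtOne : Fin m → Carrier) where

    edge∩ : Subset n → ∀ e → Fin (suc ∣ edge e ∣)
    edge∩ S e = fromℕ< {∣ edge e ∩ S ∣} (s≤s (∣p∩q∣≤∣p∣ (edge e) S))

    toℕ-edge∩ : ∀ S e → toℕ (edge∩ S e) ≡ ∣ edge e ∩ S ∣
    toℕ-edge∩ S e = Fin.toℕ-fromℕ< (s≤s (∣p∩q∣≤∣p∣ (edge e) S))

    contribution : Subset n → Fin m → Carrier
    contribution S e = weight e (edge∩ S e)

    -- Over ℝ, with the data of a hypergraph, this unfolds to `F`, and `degree` below to
    -- `weightedDegree`, so the bounds apply there without conversion.
    total : Subset n → Carrier
    total S = foldr _∙_ ε (map (contribution S) (allFin m))

    degree : Fin n → Carrier
    degree u = foldr _∙_ ε (map weightAtOne (filter (λ e → u ∈? edge e) (allFin m)))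

    degree≋sum : ∀ u → degree u ≋ ∑[ e < m ] (weightAtOne e if lookup (edge e) u)
    degree≋sum u = begin-equality
      degree u
        ≈⟨ foldr-filter (λ e → u ∈? edge e) (allFin m) weightAtOne ⟩
      foldr _∙_ ε (map (λ e → weightAtOne e if does (u ∈? edge e)) (allFin m))
        ≡⟨ foldr-tabulate id (λ e → weightAtOne e if does (u ∈? edge e)) ⟩
      ∑[ e < m ] (weightAtOne e if does (u ∈? edge e))
        ≈⟨ sum-cong-≋ (λ e → if-does-∈? u (edge e) (weightAtOne e)) ⟩
      ∑[ e < m ] (weightAtOne e if lookup (edge e) u) ∎

    -- Double counting of the pairs of an edge `e` and a vertex `u` in `e ∩ S`, each weighted by
    -- `weightAtOne e`: grouped by edge on the left, by vertex on the right.
    ∑∣e∩S∣·w≋∑degree : ∀ S →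
      ∑[ e < m ] (∣ edge e ∩ S ∣ · weightAtOne e) ≋ ∑[ u < n ] (degree u if lookup S u)
    ∑∣e∩S∣·w≋∑degree S = begin-equality
      ∑[ e < m ] (∣ edge e ∩ S ∣ · weightAtOne e)
        ≈⟨ sum-cong-≋ (λ e → sum-if-lookup (edge e ∩ S) (weightAtOne e)) ⟨
      ∑[ e < m ] ∑[ u < n ] (weightAtOne e if lookup (edge e ∩ S) u)
        ≈⟨ ∑-comm (λ e u → weightAtOne e if lookup (edge e ∩ S) u) ⟩
      ∑[ u < n ] ∑[ e < m ] (weightAtOne e if lookup (edge e ∩ S) u)
        ≈⟨ sum-cong-≋ inner ⟩
      ∑[ u < n ] (degree u if lookup S u) ∎
      where
      inner : ∀ u →
        ∑[ e < m ] (weightAtOne e if lookup (edge e ∩ S) u) ≋ (degree u if lookup S u)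
      inner u = begin-equality
        ∑[ e < m ] (weightAtOne e if lookup (edge e ∩ S) u)
          ≈⟨ sum-cong-≋ (λ e → if-lookup-∩ (edge e) S u (weightAtOne e)) ⟩
        ∑[ e < m ] ((weightAtOne e if lookup (edge e) u) if lookup S u)
          -- Whether `u` lies in `S` does not depend on `e`, so this indicator leaves the inner sum.
          ≈⟨ sum-if (lookup S u) (λ e → weightAtOne e if lookup (edge e) u) ⟩
        ((∑[ e < m ] (weightAtOne e if lookup (edge e) u)) if lookup S u)
          ≈⟨ if-cong (lookup S u) (degree≋sum u) ⟨
        (degree u if lookup S u) ∎

    module _ (nonNeg : ∀ e i → ε ≼ weight e i)
             (atOne : ∀ e i → toℕ i ≡ 1 → weightAtOne e ≡ weight e i) where

      -- Edge by edge: an edge through `v` has the same term on both sides, and an edge avoiding `v`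
      -- has `ε` on the left and a nonnegative weight on the right.
      degree≼total⁅⁆ : ∀ v → degree v ≼ total ⁅ v ⁆
      degree≼total⁅⁆ v = begin
        degree v                                          ≈⟨ degree≋sum v ⟩
        ∑[ e < m ] (weightAtOne e if lookup (edge e) v)   ≲⟨ sum-mono (λ e → bound e _ refl) ⟩
        sum (contribution ⁅ v ⁆)                          ≡⟨ foldr-tabulate id (contribution ⁅ v ⁆) ⟨
        total ⁅ v ⁆                                       ∎
        where
        bound : ∀ e b → lookup (edge e) v ≡ b →
          (weightAtOne e if b) ≼ contribution ⁅ v ⁆ e
        bound e false _   = nonNeg e _
        bound e true  v∈e = Preorder.reflexive preorder (CommutativeMonoid.reflexive commutativeMonoid
          (atOne e _ (trans (toℕ-edge∩ ⁅ v ⁆ e) (∣p∩⁅u⁆∣≡1 (edge e) v v∈e))))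

      total≼∣S∣·total⁅v⁆ : (∀ e i → weight e i ≼ toℕ i · weightAtOne e) →
        ∀ {v} → (∀ u → degree u ≼ degree v) → ∀ S → total S ≼ ∣ S ∣ · total ⁅ v ⁆
      total≼∣S∣·total⁅v⁆ subhomogeneous {v} v-max S = begin
        total S
          ≡⟨ foldr-tabulate id (contribution S) ⟩
        sum (contribution S)
          ≲⟨ sum-mono (λ e → subst (λ k → contribution S e ≼ k · weightAtOne e)
               (toℕ-edge∩ S e) (subhomogeneous e (edge∩ S e))) ⟩
        ∑[ e < m ] (∣ edge e ∩ S ∣ · weightAtOne e)
          ≈⟨ ∑∣e∩S∣·w≋∑degree S ⟩
        ∑[ u < n ] (degree u if lookup S u)
          ≲⟨ sum-mono (λ u → if-mono (lookup S u) (v-max u)) ⟩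
        ∑[ u < n ] (degree v if lookup S u)
          ≈⟨ sum-if-lookup S (degree v) ⟩
        ∣ S ∣ · degree v
          ≲⟨ ·-monoʳ ∣ S ∣ (degree≼total⁅⁆ v) ⟩
        ∣ S ∣ · total ⁅ v ⁆ ∎

-- The real numbers as an ordered commutative monoid

p≤∣p∣ : ∀ p → p ℚ.≤ ℚ.∣ p ∣
p≤∣p∣ p with ℚ.≤-total 0ℚ p
... | inj₁ 0≤p = ℚ.≤-reflexive (sym (ℚ.0≤p⇒∣p∣≡p 0≤p))
... | inj₂ p≤0 = ℚ.≤-trans p≤0 (ℚ.0≤∣p∣ p)

∣p-q∣≡∣q-p∣ : ∀ p q → ℚ.∣ p ℚ.- q ∣ ≡ ℚ.∣ q ℚ.- p ∣
∣p-q∣≡∣q-p∣ p q = trans (sym (ℚ.∣-p∣≡∣p∣ (p ℚ.- q))) (cong ℚ.∣_∣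
  (solve 2 (λ p q → :- (p :+ :- q) := q :+ :- p) refl p q))
  where open ℚ-Solver

p-q+q≡p : ∀ p q → p ℚ.- q ℚ.+ q ≡ p
p-q+q≡p = solve 2 (λ p q → p :+ :- q :+ q := p) refl
  where open ℚ-Solver

p<q+r⇒p-q<r : ∀ p q r → p ℚ.< q ℚ.+ r → p ℚ.- q ℚ.< r
p<q+r⇒p-q<r p q r h = subst (p ℚ.- q ℚ.<_)
  (solve 2 (λ q r → q :+ r :+ :- q := r) refl q r) (ℚ.+-monoˡ-< (ℚ.- q) h)
  where open ℚ-Solver

∣p-q∣<r⇒p<q+r : ∀ p q r → ℚ.∣ p ℚ.- q ∣ ℚ.< r → p ℚ.< q ℚ.+ r
∣p-q∣<r⇒p<q+r p q r h = subst (ℚ._< q ℚ.+ r)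
  (trans (ℚ.+-comm q (p ℚ.- q)) (p-q+q≡p p q))
  (ℚ.+-monoʳ-< q (ℚ.≤-<-trans (p≤∣p∣ (p ℚ.- q)) h))

∣p-q∣<r : ∀ p q r → p ℚ.< q ℚ.+ r → q ℚ.< p ℚ.+ r → ℚ.∣ p ℚ.- q ∣ ℚ.< r
∣p-q∣<r p q r p<q+r q<p+r with ℚ.∣p∣≡p∨∣p∣≡-p (p ℚ.- q)
... | inj₁ eq = subst (ℚ._< r) (sym eq) (p<q+r⇒p-q<r p q r p<q+r)
... | inj₂ eq = subst (ℚ._< r)
  (trans (solve 2 (λ p q → q :+ :- p := :- (p :+ :- q)) refl p q) (sym eq))
  (p<q+r⇒p-q<r q p r q<p+r)
  where open ℚ-Solver

-- Since _≈_ and _≤_ unfold to statements about sequences, which do not determine the Cauchy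
-- proofs, the reals below are explicit arguments.

pointwise⇒≤ : ∀ x y → (∀ n → seq x n ℚ.≤ seq y n) → x ≤ y
pointwise⇒≤ x y h ε 0<ε = 0 , λ n _ → subst (ℚ._< seq y n ℚ.+ ε) (ℚ.+-identityʳ (seq x n))
  (ℚ.+-mono-≤-< (h n) 0<ε)

≤-trans : ∀ x y z → x ≤ y → y ≤ z → x ≤ z
≤-trans x y z x≤y y≤z ε 0<ε =
  -- Each of the two inequalities may use half of the slack.
  let N₁ , h₁ = x≤y (½ ℚ.* ε) (0<½*ε ε 0<ε)
      N₂ , h₂ = y≤z (½ ℚ.* ε) (0<½*ε ε 0<ε)
  in N₁ ⊔ N₂ , λ n N≤n → ℚ.<-trans
    (h₁ n (ℕ.≤-trans (ℕ.m≤m⊔n N₁ N₂) N≤n))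
    (subst (seq y n ℚ.+ ½ ℚ.* ε ℚ.<_)
      (trans (ℚ.+-assoc (seq z n) (½ ℚ.* ε) (½ ℚ.* ε)) (cong (seq z n ℚ.+_) (halves ε)))
      (ℚ.+-monoˡ-< (½ ℚ.* ε) (h₂ n (ℕ.≤-trans (ℕ.m≤n⊔m N₁ N₂) N≤n))))

-- Two one-sided bounds with the same `ε` make the two-sided one. The congruence and transitivity of
-- `_≈_` are derived through this from their counterparts for `_≤_`.
≤-antisym : ∀ x y → x ≤ y → y ≤ x → x ≈ y
≤-antisym x y x≤y y≤x ε 0<ε =
  let N₁ , h₁ = x≤y ε 0<ε
      N₂ , h₂ = y≤x ε 0<ε
  in N₁ ⊔ N₂ , λ n N≤n → ∣p-q∣<r (seq x n) (seq y n) ε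
    (h₁ n (ℕ.≤-trans (ℕ.m≤m⊔n N₁ N₂) N≤n)) (h₂ n (ℕ.≤-trans (ℕ.m≤n⊔m N₁ N₂) N≤n))

≈⇒≤ : ∀ x y → x ≈ y → x ≤ y
≈⇒≤ x y x≈y ε 0<ε =
  let N , h = x≈y ε 0<ε
  in N , λ n N≤n → ∣p-q∣<r⇒p<q+r (seq x n) (seq y n) ε (h n N≤n)

≈-sym : ∀ x y → x ≈ y → y ≈ x
≈-sym x y x≈y ε 0<ε =
  let N , h = x≈y ε 0<ε
  in N , λ n N≤n → subst (ℚ._< ε) (∣p-q∣≡∣q-p∣ (seq x n) (seq y n)) (h n N≤n)

-- Carries the algebraic laws of ℚ over to ℝ term by term.
pointwise⇒≈ : ∀ x y → (∀ n → seq x n ≡ seq y n) → x ≈ y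
pointwise⇒≈ x y h = ≤-antisym x y
  (pointwise⇒≤ x y (ℚ.≤-reflexive ∘ h)) (pointwise⇒≤ y x (ℚ.≤-reflexive ∘ sym ∘ h))

≈-refl : ∀ x → x ≈ x
≈-refl x = pointwise⇒≈ x x λ _ → refl

≈-trans : ∀ x y z → x ≈ y → y ≈ z → x ≈ z
≈-trans x y z x≈y y≈z = ≤-antisym x z
  (≤-trans x y z (≈⇒≤ x y x≈y) (≈⇒≤ y z y≈z))
  (≤-trans z y x (≈⇒≤ z y (≈-sym y z y≈z)) (≈⇒≤ y x (≈-sym x y x≈y)))

+-mono-≤ : ∀ x y u v → x ≤ y → u ≤ v → x + u ≤ y + v
+-mono-≤ x y u v x≤y u≤v ε 0<ε =
  let N₁ , h₁ = x≤y (½ ℚ.* ε) (0<½*ε ε 0<ε)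
      N₂ , h₂ = u≤v (½ ℚ.* ε) (0<½*ε ε 0<ε)
  in N₁ ⊔ N₂ , λ n N≤n → subst (seq x n ℚ.+ seq u n ℚ.<_)
    (trans
      (solve 3 (λ y v δ → (y :+ δ) :+ (v :+ δ) := (y :+ v) :+ (δ :+ δ)) refl
        (seq y n) (seq v n) (½ ℚ.* ε))
      (cong (seq y n ℚ.+ seq v n ℚ.+_) (halves ε)))
    (ℚ.+-mono-< (h₁ n (ℕ.≤-trans (ℕ.m≤m⊔n N₁ N₂) N≤n)) (h₂ n (ℕ.≤-trans (ℕ.m≤n⊔m N₁ N₂) N≤n)))
  where open ℚ-Solver

+-cong : ∀ x y u v → x ≈ y → u ≈ v → x + u ≈ y + v
+-cong x y u v x≈y u≈v = ≤-antisym (x + u) (y + v)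
  (+-mono-≤ x y u v (≈⇒≤ x y x≈y) (≈⇒≤ u v u≈v))
  (+-mono-≤ y x v u (≈⇒≤ y x (≈-sym x y x≈y)) (≈⇒≤ v u (≈-sym u v u≈v)))

≈-isEquivalence : IsEquivalence _≈_
≈-isEquivalence = record
  { refl  = λ {x} → ≈-refl x
  ; sym   = λ {x} {y} → ≈-sym x y
  ; trans = λ {x} {y} {z} → ≈-trans x y z
  }

ℝ-orderedCommutativeMonoid : OrderedCommutativeMonoid 0ℓ 0ℓ 0ℓ
ℝ-orderedCommutativeMonoid = record
  { commutativeMonoid = record
    { Carrier = ℝ
    ; _≈_ = _≈_
    ; _∙_ = _+_
    ; ε = 0ℝ
    ; isCommutativeMonoid = record
      { isMonoid = record
        { isSemigroup = record
          { isMagma = record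
            { isEquivalence = ≈-isEquivalence
            ; ∙-cong = λ {x} {y} {u} {v} → +-cong x y u v
            }
          ; assoc = λ x y z → pointwise⇒≈ (x + y + z) (x + (y + z))
              λ n → ℚ.+-assoc (seq x n) (seq y n) (seq z n)
          }
        ; identity = (λ x → pointwise⇒≈ (0ℝ + x) x λ n → ℚ.+-identityˡ (seq x n))
                   , (λ x → pointwise⇒≈ (x + 0ℝ) x λ n → ℚ.+-identityʳ (seq x n))
        }
      ; comm = λ x y → pointwise⇒≈ (x + y) (y + x) λ n → ℚ.+-comm (seq x n) (seq y n)
      }
    }
  ; _≼_ = _≤_
  ; isPreorder = record
    { isEquivalence = ≈-isEquivalence
    ; reflexive = λ {x} {y} → ≈⇒≤ x y
    ; trans = λ {x} {y} {z} → ≤-trans x y z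
    }
  ; ∙-mono = λ {x} {y} {u} {v} → +-mono-≤ x y u v
  }

open MonoidMult (OrderedCommutativeMonoid.monoid ℝ-orderedCommutativeMonoid)
  using () renaming (_×_ to _·_)
open SemiringMult (Ring.semiring ℚ.+-*-ring) using (×-comm-*; ×-assoc-*) renaming (_×_ to _·ℚ_)

x-y+y≈x : ∀ x y → x - y + y ≈ x
x-y+y≈x x y = pointwise⇒≈ (x - y + y) x λ n → p-q+q≡p (seq x n) (seq y n)

x-y≤z⇒x≤z+y : ∀ x y z → x - y ≤ z → x ≤ z + y
x-y≤z⇒x≤z+y x y z h = ≤-trans x (x - y + y) (z + y)
  (≈⇒≤ x (x - y + y) (≈-sym (x - y + y) x (x-y+y≈x x y)))
  (+-mono-≤ (x - y) z y y h (≈⇒≤ y y (≈-refl y)))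

0≤y⇒x-y≤x : ∀ x y → 0ℝ ≤ y → x - y ≤ x
0≤y⇒x-y≤x x y 0≤y = ≤-trans (x - y) (x - y + 0ℝ) x
  (pointwise⇒≤ (x - y) (x - y + 0ℝ) λ n → ℚ.≤-reflexive (sym (ℚ.+-identityʳ (seq (x - y) n))))
  (≤-trans (x - y + 0ℝ) (x - y + y) x
    (+-mono-≤ (x - y) (x - y) 0ℝ y (≈⇒≤ (x - y) (x - y) (≈-refl (x - y))) 0≤y)
    (≈⇒≤ (x - y + y) x (x-y+y≈x x y)))

-- Division by a positive integer

1/k+j/k : ∀ j k → (+ 1 ℚ./ suc k) ℚ.+ (+ j ℚ./ suc k) ≡ + suc j ℚ./ suc k
1/k+j/k j k = ℚ.toℚᵘ-injective (ℚᵘ.≃-trans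
  (ℚ.toℚᵘ-homo-+ (+ 1 ℚ./ suc k) (+ j ℚ./ suc k))
  (ℚᵘ.≃-trans
    (ℚᵘ.+-cong (ℚ.toℚᵘ-fromℚᵘ (ℚᵘ.mkℚᵘ (+ 1) k)) (ℚ.toℚᵘ-fromℚᵘ (ℚᵘ.mkℚᵘ (+ j) k)))
    (ℚᵘ.≃-trans
      -- Without normalisation no gcd occurs, and cross-multiplying leaves an integer identity.
      -- `pos-*` enters because the product of the denominators is formed in ℕ.
      (ℚᵘ.*≡* (trans
        (solve 2 (λ j d → (con (+ 1) :* d :+ j :* d) :* d := (con (+ 1) :+ j) :* (d :* d))
          refl (+ j) (+ suc k))
        (cong (+ suc j ℤ.*_) (sym (ℤ.pos-* (suc k) (suc k))))))
      (ℚᵘ.≃-sym (ℚ.toℚᵘ-fromℚᵘ (ℚᵘ.mkℚᵘ (+ suc j) k))))))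
  where open ℤ-Solver

-- The numerator is separated from the denominator so that induction can run on it alone; the case
-- wanted later is `j` equal to `suc k`.
j·1/k≡j/k : ∀ j k → j ·ℚ (+ 1 ℚ./ suc k) ≡ + j ℚ./ suc k
-- `mkℚᵘ` stores the denominator minus one: the two fractions are 0/1 and 0/(k+1).
j·1/k≡j/k zero    k = ℚ.fromℚᵘ-cong {ℚᵘ.mkℚᵘ (+ 0) 0} {ℚᵘ.mkℚᵘ (+ 0) k} (ℚᵘ.*≡* refl)
j·1/k≡j/k (suc j) k = trans (cong ((+ 1 ℚ./ suc k) ℚ.+_) (j·1/k≡j/k j k)) (1/k+j/k j k)

k·1/k≡1 : ∀ k .{{_ : NonZero k}} → k ·ℚ (+ 1 ℚ./ k) ≡ 1ℚ
k·1/k≡1 (suc k) = trans (j·1/k≡j/k (suc k) k)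
  (ℚ.fromℚᵘ-cong {ℚᵘ.mkℚᵘ (+ suc k) k} {ℚᵘ.mkℚᵘ (+ 1) 0} (ℚᵘ.*≡* (ℤ.*-comm (+ suc k) (+ 1))))

seq-· : ∀ k x n → seq (k · x) n ≡ k ·ℚ seq x n
seq-· zero    x n = refl
seq-· (suc k) x n = cong (seq x n ℚ.+_) (seq-· k x n)

-- In each term the `k`-fold sum is moved from `q` onto `r`, where it gives 1.
÷-· : ∀ k .{{_ : NonZero k}} x → (k · x) ÷ k ≈ x
÷-· k x = pointwise⇒≈ ((k · x) ÷ k) x λ n →
  let r = + 1 ℚ./ k
      q = seq x n
  in trans (cong (r ℚ.*_) (seq-· k x n))
    (trans (×-comm-* k r q)
    (trans (sym (×-assoc-* k r q))
    (trans (cong (ℚ._* q) (k·1/k≡1 k)) (ℚ.*-identityˡ q))))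

-- Scaling by 1/k, which is at most 1, does not enlarge the slack, so the same `N` serves for the
-- same `ε`.
÷-mono-≤ : ∀ k .{{_ : NonZero k}} x y → x ≤ y → x ÷ k ≤ y ÷ k
÷-mono-≤ k@(suc _) x y x≤y ε 0<ε =
  let N , h = x≤y ε 0<ε
      r = + 1 ℚ./ k
      instance
        r-pos : ℚ.Positive r
        r-pos = ℚ.normalize-pos 1 k
        ε-nonNeg : ℚ.NonNegative ε
        ε-nonNeg = ℚ.nonNegative (ℚ.<⇒≤ 0<ε)
  in N , λ n N≤n → ℚ.<-≤-trans
    (ℚ.*-monoʳ-<-pos r (h n N≤n))
    (ℚ.≤-trans
      (ℚ.≤-reflexive (ℚ.*-distribˡ-+ r (seq y n) ε))
      (ℚ.+-monoʳ-≤ (r ℚ.* seq y n)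
        (ℚ.≤-trans (ℚ.*-monoʳ-≤-nonNeg ε (1/k≤1 k)) (ℚ.≤-reflexive (ℚ.*-identityˡ ε)))))

x≤x÷1 : ∀ x → x ≤ x ÷ 1
x≤x÷1 x = pointwise⇒≤ x (x ÷ 1) λ n → ℚ.≤-reflexive (sym (ℚ.*-identityˡ (seq x n)))

-- The proofs of `NonZero` are irrelevant, so once `k` and `l` are identified the two quotients
-- coincide.
÷-congʳ : ∀ {k l} .{{_ : NonZero k}} .{{_ : NonZero l}} x → k ≡ l → x ÷ k ≈ x ÷ l
÷-congʳ {k} x refl = ≈-refl (x ÷ k)

-- Densest sub-hypergraphs

-- By concavity no increment exceeds the one before it, hence none exceeds the first,
-- `w one - w zero`, which is at most `w one`. The index `one` is fixed by its value because `c` is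
-- not syntactically a successor.
concave⇒increment≤first : ∀ {c} (w : Fin (suc c) → ℝ) → Concave w → 0ℝ ≤ w zero →
  ∀ {one} → toℕ one ≡ 1 → ∀ i j → toℕ j ≡ suc (toℕ i) → w j - w i ≤ w one
concave⇒increment≤first w concave 0≤w₀ {one} one≡1 = <-weakInduction Bound base step
  where
  Bound : Fin _ → Set
  -- At the last index no such `j` exists and the bound is vacuous, so the induction can cover all
  -- of `Fin (suc c)`.
  Bound i = ∀ j → toℕ j ≡ suc (toℕ i) → w j - w i ≤ w one

  base : Bound zero
  base j j≡1 with refl ← Fin.toℕ-injective (trans j≡1 (sym one≡1)) = 0≤y⇒x-y≤x (w one) (w zero) 0≤w₀

  step : ∀ i → Bound (inject₁ i) → Bound (suc i)
  step i ih j j≡ = ≤-trans (w j - w (suc i)) (w (suc i) - w (inject₁ i)) (w one)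
    (concave (inject₁ i) (suc i) j eq j≡) (ih (suc i) eq)
    where
    eq : suc (toℕ i) ≡ suc (toℕ (inject₁ i))
    eq = cong suc (sym (Fin.toℕ-inject₁ i))

module _ (H : Hypergraph) where
  open Hypergraph H
  open EdgeWeightBounds ℝ-orderedCommutativeMonoid

  density-singleton : ∀ v → density (singleton v) ≈ F ⁅ v ⁆ ÷ 1
  density-singleton v = ÷-congʳ
    {{ℕ.>-nonZero (nonempty⇒0<∣p∣ (proj₂ (singleton v)))}} (F ⁅ v ⁆) (∣⁅x⁆∣≡1 v)

  module _ (concave : ∀ e → Concave (weight e)) (weight₀≈0 : ∀ e → weight e zero ≈ 0ℝ)
           {v : Vertex} (v-max : v ∈argmax weightedDegree) where

    F≤∣S∣·F⁅v⁆ : ∀ S → F S ≤ ∣ S ∣ · F ⁅ v ⁆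
    F≤∣S∣·F⁅v⁆ = total≼∣S∣·total⁅v⁆ edge weight weightAtOne weight-nonNeg
      -- The index inside `weightAtOne` and `i` are built differently but both have value 1.
      (λ e i i≡1 → cong (weight e) (Fin.toℕ-injective (trans (one≡1 e) (sym i≡1))))
      (λ e → increments≼⇒subhomogeneous (weight e) (weightAtOne e)
        (≈⇒≤ (weight e zero) 0ℝ (weight₀≈0 e))
        (λ i j j≡ → x-y≤z⇒x≤z+y (weight e j) (weight e i) (weightAtOne e)
          (concave⇒increment≤first (weight e) (concave e) (weight-nonNeg e zero)
            (one≡1 e) i j j≡)))
      {v} v-max
      where
      one≡1 : ∀ e → toℕ (fromℕ< {1} (s≤s (nonempty⇒0<∣p∣ (edge-nonempty e)))) ≡ 1
      one≡1 e = Fin.toℕ-fromℕ< (s≤s (nonempty⇒0<∣p∣ (edge-nonempty e)))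

    density≤F⁅v⁆÷1 : ∀ S → density S ≤ F ⁅ v ⁆ ÷ 1
    density≤F⁅v⁆÷1 (S , S≢∅) =
      ≤-trans (F S ÷ ∣ S ∣) ((∣ S ∣ · F ⁅ v ⁆) ÷ ∣ S ∣) (F ⁅ v ⁆ ÷ 1)
        (÷-mono-≤ ∣ S ∣ (F S) (∣ S ∣ · F ⁅ v ⁆) (F≤∣S∣·F⁅v⁆ S))
        (≤-trans ((∣ S ∣ · F ⁅ v ⁆) ÷ ∣ S ∣) (F ⁅ v ⁆) (F ⁅ v ⁆ ÷ 1)
          (≈⇒≤ ((∣ S ∣ · F ⁅ v ⁆) ÷ ∣ S ∣) (F ⁅ v ⁆) (÷-· ∣ S ∣ (F ⁅ v ⁆)))
          (x≤x÷1 (F ⁅ v ⁆)))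
      where
      instance
        ∣S∣≢0 : NonZero ∣ S ∣
        ∣S∣≢0 = ℕ.>-nonZero (nonempty⇒0<∣p∣ S≢∅)

theorem6 : (H : Hypergraph) → let open Hypergraph H in
    (∀ e → NonDecreasing (weight e)) →
    (∀ e → Concave (weight e)) →
    (∀ e → weight e zero ≈ 0ℝ) →
    ∀ (v : Vertex) → v ∈argmax weightedDegree →
    IsOptimalGDSH (singleton v) × ((F ⁅ v ⁆ ÷ 1) IsMaximumOf density)
theorem6 H _ concave weight₀≈0 v v-max =
    -- The bound divides by 1 while `density (singleton v)` divides by `∣ ⁅ v ⁆ ∣`; `attained` links
    -- the two and also witnesses that the maximum is reached.
    (λ S → ≤-trans (density S) (F ⁅ v ⁆ ÷ 1) (density (singleton v)) (bound S)
      (≈⇒≤ (F ⁅ v ⁆ ÷ 1) (density (singleton v)) (≈-sym (density (singleton v)) (F ⁅ v ⁆ ÷ 1) attained)))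
  , (singleton v , attained) , bound
  where
  open Hypergraph H
  attained = density-singleton H v
  bound = density≤F⁅v⁆÷1 H concave weight₀≈0 v-max
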